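{- There is an infinite word over the ternary alphabet $\{0,1,2\}$ none of whose factors is a $2$-abelian-square of period at least $2$.
   Context: For finite words $u,w$, $|u|_w$ denotes the number of occurrences of $w$ as a factor of $u$. For $k\ge 1$, two finite words $u,v$ are $k$-abelian equivalent if $|u|_w=|v|_w$ for every non-empty word $w$ with $|w|\le k$. A $k$-abelian-square is a non-empty word $u_1u_2$ with $u_1$ and $u_2$ $k$-abelian equivalent; its period is $|u_1|$. -}

module Defs where

open import Data.Fin.Base using (Fin)
open import Data.Fin.Properties using (_≟_)
open import Data.List.Base using (List; []; _++_; length; filter; tails; applyUpTo)
open import Data.List.Relation.Binary.Prefix.Heterogeneous.Properties using (prefix?)
open import Data.Nat.Base using (ℕ; _+_; _≤_)
open import Data.Product.Base using (∃-syntax)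
open import Relation.Binary.PropositionalEquality using (_≡_; _≢_)

Word : ℕ → Set
Word q = List (Fin q)

InfiniteWord : ℕ → Set
InfiniteWord q = ℕ → Fin q

_IsFactorOf_ : ∀ {q} → Word q → InfiniteWord q → Set
v IsFactorOf x = ∃[ i ] v ≡ applyUpTo (λ j → x (i + j)) (length v)

-- ∣ u ∣[ w ] is |u|_w: each suffix of u that begins with w is one occurrence,
-- so overlapping occurrences are all counted. For w = [] this also counts the
-- empty suffix, but only non-empty w are used below.
∣_∣[_] : ∀ {q} → Word q → Word q → ℕ
∣ u ∣[ w ] = length (filter (prefix? _≟_ w) (tails u))

KAbelianEquivalent : ∀ {q} → ℕ → Word q → Word q → Set
KAbelianEquivalent k u v =
  ∀ w → w ≢ [] → length w ≤ k → ∣ u ∣[ w ] ≡ ∣ v ∣[ w ]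

-- A decomposition of v exhibiting it as a k-abelian-square (meaningful for k ≥ 1).
record KAbelianSquare {q : ℕ} (k : ℕ) (v : Word q) : Set where
  field
    u₁ u₂      : Word q
    split      : v ≡ u₁ ++ u₂
    nonEmpty   : v ≢ []
    equivalent : KAbelianEquivalent k u₁ u₂

  period : ℕ
  period = length u₁

{-# OPTIONS --safe #-}

-- The word is g(w), where w is the fixed point of the 12-uniform morphism h : a ↦ 012140414310 + a
-- on ℤ/5 and g is the 5-uniform morphism 0 ↦ 00112, 1 ↦ 00212, 2 ↦ 02201, 3 ↦ 02211, 4 ↦ 02220;
-- both were found by computer search.
-- An abelian square of w at i < j < k means P(i) + P(k) = 2 P(j) for the Parikh vectors P(n) of the
-- prefixes. Reducing the equation modulo the image of the incidence matrix of h leaves few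
-- combinations of blocks and offsets of i, j, k, and in each of them the three positions can be moved
-- to ends of their blocks without breaking the equation. The matrix being injective, this is an abelian
-- square of w ending earlier, unless the three ends coincide; then the square lies in two
-- adjacent blocks, which is a finite check. So w has no abelian square.
-- For a 2-abelian square of g(w) the word of pairs of consecutive letters satisfies
-- P(i) + P(k) = P(j) + P(j + 1), and the same descent turns it into an abelian square of w.

module Submission where

open import Defs
open import Data.Bool.Base using (true; false; if_then_else_; _∧_)
open import Data.Bool.Properties using (∧-identityʳ)
open import Data.Empty using (⊥)
open import Data.Fin.Base using (Fin; zero; suc; toℕ; combine)
open import Data.Fin.Patterns using (0F; 1F; 2F; 3F; 4F)
open import Data.Fin.Properties using (_≟_; all?; any?; toℕ<n; combine-injective; combine-surjective)
open import Data.List.Base using (List; []; _∷_; _++_; length; applyUpTo)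
open import Data.List.Properties using (∷-injective)
open import Data.Nat.Base
open import Data.Nat.DivMod
open import Data.Nat.Divisibility using (_∣_; ∣-refl; ∣m∣n⇒∣m+n; _∣0; m%n≡0⇒n∣m; n∣m*n)
open import Data.Nat.Properties hiding (_≟_)
import Data.Nat.Properties as ℕ
open import Data.Nat.Tactic.RingSolver using (solve-∀)
open import Data.Product.Base using (Σ-syntax; ∃-syntax; _×_; _,_)
open import Data.Sum.Base using (inj₁; inj₂)
open import Function.Bundles using (mk⇔)
open import Relation.Binary.PropositionalEquality
open import Relation.Nullary using (¬_; Dec; yes; no; does; ofʸ; ofⁿ)
open import Relation.Nullary.Decidable using (_→-dec_; _×-dec_; ¬?; does-⇔; from-yes)
open import Algebra.Properties.Semiring.Sum +-*-semiring
  using (sum; sum-cong-≗; sum-replicate-zero; ∑-distrib-+; *-distribˡ-sum)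

-- Prefix sums of letter weights.

mass : {A : Set} → (A → ℕ) → (ℕ → A) → ℕ → ℕ
mass f x zero    = 0
mass f x (suc n) = mass f x n + f (x n)

mass-+ : {A : Set} (f : A → ℕ) (x : ℕ → A) (m n : ℕ) →
         mass f x (m + n) ≡ mass f x m + mass f (λ t → x (m + t)) n
mass-+ f x m zero    = trans (cong (mass f x) (+-identityʳ m)) (sym (+-identityʳ _))
mass-+ f x m (suc n) = begin
  mass f x (m + suc n)                                        ≡⟨ cong (mass f x) (+-suc m n) ⟩
  mass f x (m + n) + f (x (m + n))                            ≡⟨ cong (_+ f (x (m + n))) (mass-+ f x m n) ⟩
  mass f x m + mass f (λ t → x (m + t)) n + f (x (m + n))     ≡⟨ +-assoc (mass f x m) _ _ ⟩
  mass f x m + (mass f (λ t → x (m + t)) n + f (x (m + n)))   ∎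
  where open ≡-Reasoning

mass-cong : {A : Set} (f : A → ℕ) {x y : ℕ → A} (n : ℕ) →
            (∀ {t} → t < n → x t ≡ y t) → mass f x n ≡ mass f y n
mass-cong f zero    x≗y = refl
mass-cong f (suc n) x≗y =
  cong₂ _+_ (mass-cong f n λ t<n → x≗y (m<n⇒m<1+n t<n)) (cong f (x≗y ≤-refl))

mass-cong-weight : {A : Set} {f g : A → ℕ} (x : ℕ → A) (n : ℕ) →
                   (∀ a → f a ≡ g a) → mass f x n ≡ mass g x n
mass-cong-weight x zero    f≗g = refl
mass-cong-weight x (suc n) f≗g = cong₂ _+_ (mass-cong-weight x n f≗g) (f≗g (x n))

mass-affine : {A : Set} (f : A → ℕ) (D K : ℕ) (x : ℕ → A) (n : ℕ) →
              mass (λ a → D * f a + K) x n ≡ D * mass f x n + n * K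
mass-affine f D K x zero    = sym (trans (+-identityʳ (D * 0)) (*-zeroʳ D))
mass-affine f D K x (suc n) = begin
  mass (λ a → D * f a + K) x n + (D * f (x n) + K)  ≡⟨ cong (_+ (D * f (x n) + K)) (mass-affine f D K x n) ⟩
  D * mass f x n + n * K + (D * f (x n) + K)        ≡⟨ rearrange D (mass f x n) (f (x n)) K n ⟩
  D * (mass f x n + f (x n)) + (K + n * K)          ∎
  where
  open ≡-Reasoning
  rearrange : ∀ D u v K n → D * u + n * K + (D * v + K) ≡ D * (u + v) + (K + n * K)
  rearrange = solve-∀

mass-const : {A : Set} (c : ℕ) (x : ℕ → A) (n : ℕ) → mass (λ _ → c) x n ≡ n * c
mass-const c x zero    = refl
mass-const c x (suc n) = trans (cong (_+ c) (mass-const c x n)) (+-comm (n * c) c)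

δ : ∀ {m} → Fin m → Fin m → ℕ
δ a b = if does (a ≟ b) then 1 else 0

∑-δ : ∀ {m} (f : Fin m → ℕ) b → sum (λ a → f a * δ a b) ≡ f b
∑-δ {suc m} f zero = begin
  f zero * 1 + sum (λ a → f (suc a) * 0)  ≡⟨ cong₂ _+_ (*-identityʳ (f zero)) (sum-cong-≗ λ a → *-zeroʳ (f (suc a))) ⟩
  f zero + sum {m} (λ _ → 0)              ≡⟨ cong (f zero +_) (sum-replicate-zero m) ⟩
  f zero + 0                              ≡⟨ +-identityʳ (f zero) ⟩
  f zero                                  ∎
  where open ≡-Reasoning
∑-δ {suc m} f (suc b) = cong₂ _+_ (*-zeroʳ (f zero)) (∑-δ (λ a → f (suc a)) b)

-- A weight is a combination of the indicators `δ a`, whose prefix sums are the entries of the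
-- Parikh vectors.
mass-∑ : ∀ {m} (f : Fin m → ℕ) (x : ℕ → Fin m) n →
         mass f x n ≡ sum (λ a → f a * mass (δ a) x n)
mass-∑ {m} f x zero    = sym (trans (sum-cong-≗ λ a → *-zeroʳ (f a)) (sum-replicate-zero m))
mass-∑ f x (suc n) = begin
  mass f x n + f (x n)
    ≡⟨ cong₂ _+_ (mass-∑ f x n) (sym (∑-δ f (x n))) ⟩
  sum (λ a → f a * mass (δ a) x n) + sum (λ a → f a * δ a (x n))
    ≡⟨ ∑-distrib-+ (λ a → f a * mass (δ a) x n) _ ⟨
  sum (λ a → f a * mass (δ a) x n + f a * δ a (x n))
    ≡⟨ sum-cong-≗ (λ a → *-distribˡ-+ (f a) _ _) ⟨
  sum (λ a → f a * (mass (δ a) x n + δ a (x n))) ∎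
  where open ≡-Reasoning

-- Balanced triples of positions.

-- With ι = 0 an abelian square x[i..j) x[j..k), and with ι = 1 two factors x[i..j) and x[j+1..k)
-- with the same letter counts.
BalancedFor : {A : Set} → (A → ℕ) → (ℕ → A) → ℕ → ℕ → ℕ → ℕ → Set
BalancedFor f x ι i j k = mass f x i + mass f x k ≡ mass f x j + mass f x (ι + j)

record Balanced {A : Set} (x : ℕ → A) (ι i j k : ℕ) : Set where
  constructor balanced
  field
    balances : ∀ f → BalancedFor f x ι i j k

open Balanced

mass-∑₂ : ∀ {m} (f : Fin m → ℕ) (x : ℕ → Fin m) i j →
          mass f x i + mass f x j ≡ sum (λ a → f a * (mass (δ a) x i + mass (δ a) x j))
mass-∑₂ f x i j = begin
  mass f x i + mass f x j
    ≡⟨ cong₂ _+_ (mass-∑ f x i) (mass-∑ f x j) ⟩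
  sum (λ a → f a * mass (δ a) x i) + sum (λ a → f a * mass (δ a) x j)
    ≡⟨ ∑-distrib-+ (λ a → f a * mass (δ a) x i) _ ⟨
  sum (λ a → f a * mass (δ a) x i + f a * mass (δ a) x j)
    ≡⟨ sum-cong-≗ (λ a → *-distribˡ-+ (f a) _ _) ⟨
  sum (λ a → f a * (mass (δ a) x i + mass (δ a) x j)) ∎
  where open ≡-Reasoning

-- Both sides of the balance equation are linear in the weight, so the indicators of the letters
-- decide it.
balanced-δ : ∀ {m} (x : ℕ → Fin m) ι {i j k} →
             (∀ a → BalancedFor (δ a) x ι i j k) → Balanced x ι i j k
balanced-δ x ι {i} {j} {k} bal = balanced λ f →
  trans (mass-∑₂ f x i k)
        (trans (sum-cong-≗ λ a → cong (f a *_) (bal a)) (sym (mass-∑₂ f x j (ι + j))))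

mass-1 : {A : Set} (x : ℕ → A) (n : ℕ) → mass (λ _ → 1) x n ≡ n
mass-1 x n = trans (mass-const 1 x n) (*-identityʳ n)

balanced-lengths : {A : Set} {x : ℕ → A} {ι i j k : ℕ} → Balanced x ι i j k → i + k ≡ j + (ι + j)
balanced-lengths {x = x} {ι} {i} {j} {k} bal = begin
  i + k                                            ≡⟨ cong₂ _+_ (mass-1 x i) (mass-1 x k) ⟨
  mass (λ _ → 1) x i + mass (λ _ → 1) x k          ≡⟨ balances bal (λ _ → 1) ⟩
  mass (λ _ → 1) x j + mass (λ _ → 1) x (ι + j)    ≡⟨ cong₂ _+_ (mass-1 x j) (mass-1 x (ι + j)) ⟩
  j + (ι + j)                                      ∎
  where open ≡-Reasoning

-- Only the end is bounded: the descent assumes that no abelian square of `w` ends before the square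
-- at hand.
SquareFreeBelow : {A : Set} → (ℕ → A) → ℕ → Set
SquareFreeBelow w n = ∀ {i j k} → i < j → k < n → ¬ Balanced w 0 i j k

midpoint-< : ∀ {i j k} → i + k ≡ j + j → i < j → j < k
midpoint-< {i} {j} {k} i+k≡j+j i<j = ≰⇒> λ k≤j → <⇒≢ (+-mono-<-≤ i<j k≤j) i+k≡j+j

midpoint-≤ : ∀ {i j k} → i + k ≡ j + j → j ≤ i → k ≤ i
midpoint-≤ {i} {j} {k} i+k≡j+j j≤i = +-cancelˡ-≤ j k i (begin
  j + k   ≤⟨ +-monoˡ-≤ k j≤i ⟩
  i + k   ≡⟨ i+k≡j+j ⟩
  j + j   ≤⟨ +-monoʳ-≤ j j≤i ⟩
  j + i   ∎)
  where open ≤-Reasoning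

-- Source of the strict descent: with blocks of length at least 3, the boundary after block `n` has
-- number `n + 1`, which is less than the position where block `n` starts.
1+n<n*3 : ∀ {n} → 1 ≤ n → suc n < n * 3
1+n<n*3 {n} 1≤n = begin
  2 + n       ≤⟨ +-monoˡ-≤ n (*-monoʳ-≤ 2 1≤n) ⟩
  2 * n + n   ≡⟨ triple n ⟩
  n * 3       ∎
  where
  open ≤-Reasoning
  triple : ∀ n → 2 * n + n ≡ n * 3
  triple = solve-∀

-- Desubstitution for a uniform morphism.

-- Blocks have length q. The key vanishes modulo d on every block, so it only sees offsets inside
-- blocks; probe s takes the value D + K on the block of s and K on all others, which makes the
-- incidence matrix injective.
module Desubstitution
  {m p : ℕ} (ι q d D K : ℕ)
  .{{_ : NonZero q}} .{{_ : NonZero d}} .{{_ : NonZero D}}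
  (block : Fin m → ℕ → Fin p) (probe : Fin m → Fin p → ℕ) (key : Fin p → ℕ)
  where

  -- The transposed incidence matrix of the morphism, applied to the weight `f`.
  total : (Fin p → ℕ) → Fin m → ℕ
  total f a = mass f (block a) q

  -- Offsets α, β, γ in the blocks of a, b, c may be replaced by the starts (ε = 0) or the ends (ε = 1)
  -- of these blocks; terms are moved across so that no subtraction occurs.
  AlignedFor : (Fin p → ℕ) → (ε₁ ε₂ ε₃ : Fin 2) (α β γ : ℕ) (a b c : Fin m) → Set
  AlignedFor f ε₁ ε₂ ε₃ α β γ a b c =
    (mass f (block a) α + mass f (block c) γ) + toℕ ε₂ * (total f b + total f b)
    ≡ (mass f (block b) β + mass f (block b) (ι + β)) + (toℕ ε₁ * total f a + toℕ ε₃ * total f c)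

  -- One choice of boundaries has to serve all weights; the constant weight and the probes suffice,
  -- as they determine lengths and letter counts in `w`.
  Alignable : (α β γ : ℕ) (a b c : Fin m) → Set
  Alignable α β γ a b c =
    ∃[ ε₁ ] ∃[ ε₂ ] ∃[ ε₃ ]
      AlignedFor (λ _ → 1) ε₁ ε₂ ε₃ α β γ a b c
      × (∀ s → AlignedFor (probe s) ε₁ ε₂ ε₃ α β γ a b c)

  CongruentKeys : (α β γ : ℕ) (a b c : Fin m) → Set
  CongruentKeys α β γ a b c =
    (mass key (block a) α + mass key (block c) γ) % d
    ≡ (mass key (block b) β + mass key (block b) (ι + β)) % d

  -- Of a balanced triple only the length modulo `q` and the key modulo `d` are kept. Both depend on
  -- offsets and letters alone, which leaves finitely many cases.
  AllAlignable : Set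
  AllAlignable =
    ∀ {α} → α < q → ∀ {β} → β < q → ∀ {γ} → γ < q → (α + γ) % q ≡ (β + (ι + β)) % q →
    ∀ a b c → CongruentKeys α β γ a b c → Alignable α β γ a b c

  allAlignable? : Dec AllAlignable
  allAlignable? =
    allUpTo? (λ α → allUpTo? (λ β → allUpTo? (λ γ → (_ ℕ.≟ _) →-dec
      all? λ a → all? λ b → all? λ c → (_ ℕ.≟ _) →-dec
        any? λ ε₁ → any? λ ε₂ → any? λ ε₃ → (_ ℕ.≟ _) ×-dec all? λ s → _ ℕ.≟ _) q) q) q

  twoBlocks : Fin m → Fin m → ℕ → Fin p
  twoBlocks a b t = if t <ᵇ q then block a t else block b (t ∸ q)

  -- The second block matters only if γ reaches it, and in a square-free w it then differs from the first.
  NoShortSquare : Set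
  NoShortSquare =
    ∀ {β} → β < q + q → ∀ {γ} → γ < q + q → suc ι + β ≤ γ →
    ∀ {α} → α < q + q → α + γ ≡ β + (ι + β) →
    ∀ a b → ¬ (a ≡ b × q ≤ γ) → ¬ BalancedFor key (twoBlocks a b) ι α β γ

  noShortSquare? : Dec NoShortSquare
  noShortSquare? =
    allUpTo? (λ β → allUpTo? (λ γ → (_ ≤? _) →-dec allUpTo? (λ α → (_ ℕ.≟ _) →-dec
      all? λ a → all? λ b → ¬? ((a ≟ b) ×-dec (q ≤? γ)) →-dec ¬? (_ ℕ.≟ _)) (q + q)) (q + q)) (q + q)

  KeyDivides : Set
  KeyDivides = ∀ a → total key a % d ≡ 0

  keyDivides? : Dec KeyDivides
  keyDivides? = all? λ a → _ ℕ.≟ _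

  ProbesSeparate : Set
  ProbesSeparate = ∀ s a → total (probe s) a ≡ D * δ s a + K

  probesSeparate? : Dec ProbesSeparate
  probesSeparate? = all? λ s → all? λ a → _ ℕ.≟ _

  module Image
    (3≤q : 3 ≤ q) (ι≤1 : ι ≤ 1)
    (keyDivides : KeyDivides) (probesSeparate : ProbesSeparate)
    (allAlignable : AllAlignable) (noShortSquare : NoShortSquare)
    (w : ℕ → Fin m) (x : ℕ → Fin p)
    (x-blocks : ∀ N {t} → t < q → x (N * q + t) ≡ block (w N) t)
    where

    mass-aligned : ∀ f N → mass f x (N * q) ≡ mass (total f) w N
    mass-aligned f zero    = refl
    mass-aligned f (suc N) = begin
      mass f x (q + N * q)                                    ≡⟨ cong (mass f x) (+-comm q (N * q)) ⟩
      mass f x (N * q + q)                                    ≡⟨ mass-+ f x (N * q) q ⟩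
      mass f x (N * q) + mass f (λ t → x (N * q + t)) q       ≡⟨ cong₂ _+_ (mass-aligned f N) (mass-cong f q (x-blocks N)) ⟩
      mass (total f) w N + total f (w N)                      ∎
      where open ≡-Reasoning

    mass-inside : ∀ f N {t} → t ≤ q →
                  mass f x (N * q + t) ≡ mass (total f) w N + mass f (block (w N)) t
    mass-inside f N {t} t≤q =
      trans (mass-+ f x (N * q) t)
            (cong₂ _+_ (mass-aligned f N) (mass-cong f t λ s<t → x-blocks N (<-≤-trans s<t t≤q)))

    split : ∀ i → i ≡ (i / q) * q + i % q
    split i = trans (m≡m%n+[m/n]*n i q) (+-comm (i % q) _)

    letter : ℕ → Fin m
    letter i = w (i / q)

    mass-at : ∀ f i → mass f x i ≡ mass (total f) w (i / q) + mass f (block (letter i)) (i % q)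
    mass-at f i = trans (cong (mass f x) (split i)) (mass-inside f (i / q) (<⇒≤ (m%n<n i q)))

    -- As `ι` is at most 1, the position `ι + j` is at most the end of the block of `j`, so no
    -- further letter of `w` enters.
    mass-after : ∀ f j → mass f x (ι + j) ≡ mass (total f) w (j / q) + mass f (block (letter j)) (ι + j % q)
    mass-after f j = trans (cong (mass f x) position)
                           (mass-inside f (j / q) (≤-trans (+-monoˡ-≤ (j % q) ι≤1) (m%n<n j q)))
      where
      swap : ∀ a b c → a + (b + c) ≡ b + (a + c)
      swap = solve-∀
      position : ι + j ≡ (j / q) * q + (ι + j % q)
      position = trans (cong (ι +_) (split j)) (swap ι ((j / q) * q) (j % q))

    balanced-split : ∀ f i j k → BalancedFor f x ι i j k →
      (mass f (block (letter i)) (i % q) + mass f (block (letter k)) (k % q))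
        + (mass (total f) w (i / q) + mass (total f) w (k / q))
      ≡ (mass f (block (letter j)) (j % q) + mass f (block (letter j)) (ι + j % q))
        + (mass (total f) w (j / q) + mass (total f) w (j / q))
    balanced-split f i j k bal = begin
      (pᵢ + pₖ) + (Fᵢ + Fₖ)              ≡⟨ regroup pᵢ pₖ Fᵢ Fₖ ⟩
      (Fᵢ + pᵢ) + (Fₖ + pₖ)              ≡⟨ cong₂ _+_ (mass-at f i) (mass-at f k) ⟨
      mass f x i + mass f x k            ≡⟨ bal ⟩
      mass f x j + mass f x (ι + j)      ≡⟨ cong₂ _+_ (mass-at f j) (mass-after f j) ⟩
      (Fⱼ + pⱼ) + (Fⱼ + pⱼ′)             ≡⟨ regroup pⱼ pⱼ′ Fⱼ Fⱼ ⟨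
      (pⱼ + pⱼ′) + (Fⱼ + Fⱼ)             ∎
      where
      open ≡-Reasoning
      Fᵢ = mass (total f) w (i / q)
      Fⱼ = mass (total f) w (j / q)
      Fₖ = mass (total f) w (k / q)
      pᵢ = mass f (block (letter i)) (i % q)
      pⱼ = mass f (block (letter j)) (j % q)
      pⱼ′ = mass f (block (letter j)) (ι + j % q)
      pₖ = mass f (block (letter k)) (k % q)
      regroup : ∀ a b c d → (a + b) + (c + d) ≡ (c + a) + (d + b)
      regroup = solve-∀

    ∣-mass : ∀ {n} f → (∀ a → n ∣ f a) → ∀ N → n ∣ mass f w N
    ∣-mass f n∣f zero    = _ ∣0
    ∣-mass f n∣f (suc N) = ∣m∣n⇒∣m+n (∣-mass f n∣f N) (n∣f (w N))

    -- Whole blocks contribute multiples of `n`, so the partial blocks alone satisfy the congruence.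
    balanced-% : ∀ f n .{{_ : NonZero n}} → (∀ a → n ∣ total f a) → ∀ i j k → BalancedFor f x ι i j k →
      (mass f (block (letter i)) (i % q) + mass f (block (letter k)) (k % q)) % n
      ≡ (mass f (block (letter j)) (j % q) + mass f (block (letter j)) (ι + j % q)) % n
    balanced-% f n n∣total i j k bal =
      trans (sym (%-remove-+ʳ _ (∣m∣n⇒∣m+n (n∣ (i / q)) (n∣ (k / q)))))
            (trans (cong (_% n) (balanced-split f i j k bal))
                   (%-remove-+ʳ _ (∣m∣n⇒∣m+n (n∣ (j / q)) (n∣ (j / q)))))
      where n∣ = ∣-mass (total f) n∣total

    mass-step : ∀ f (ε : Fin 2) N → mass f w (toℕ ε + N) ≡ mass f w N + toℕ ε * f (w N)
    mass-step f zero       N = sym (+-identityʳ _)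
    mass-step f (suc zero) N = cong (mass f w N +_) (sym (*-identityˡ _))

    -- Both hypotheses compare the partial-block sums `P` and `Q`; eliminating these leaves an
    -- equation between prefix sums of `w`.
    align : ∀ f i j k ε₁ ε₂ ε₃ → BalancedFor f x ι i j k →
            AlignedFor f ε₁ ε₂ ε₃ (i % q) (j % q) (k % q) (letter i) (letter j) (letter k) →
            BalancedFor (total f) w 0 (toℕ ε₁ + i / q) (toℕ ε₂ + j / q) (toℕ ε₃ + k / q)
    align f i j k ε₁ ε₂ ε₃ bal aligned =
      trans (cong₂ _+_ (mass-step (total f) ε₁ (i / q)) (mass-step (total f) ε₃ (k / q)))
        (trans (cancel P Q (total f (letter j)) Fᵢ Fₖ Fⱼ (toℕ ε₁ * total f (letter i)) (toℕ ε₃ * total f (letter k)) (toℕ ε₂)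
                  (balanced-split f i j k bal) aligned)
          (sym (cong₂ _+_ (mass-step (total f) ε₂ (j / q)) (mass-step (total f) ε₂ (j / q)))))
      where
      Fᵢ = mass (total f) w (i / q)
      Fⱼ = mass (total f) w (j / q)
      Fₖ = mass (total f) w (k / q)
      P = mass f (block (letter i)) (i % q) + mass f (block (letter k)) (k % q)
      Q = mass f (block (letter j)) (j % q) + mass f (block (letter j)) (ι + j % q)
      cancel : ∀ P Q T A C B U V e → P + (A + C) ≡ Q + (B + B) → P + e * (T + T) ≡ Q + (U + V) →
               (A + U) + (C + V) ≡ (B + e * T) + (B + e * T)
      -- Adding `P + e * (T + T)` to both sides lets both hypotheses apply without subtraction.
      cancel P Q T A C B U V e h₁ h₂ = +-cancelʳ-≡ (P + e * (T + T)) _ _ (begin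
        ((A + U) + (C + V)) + (P + e * (T + T))         ≡⟨ r₁ P T A C U V e ⟩
        (P + (A + C)) + ((U + V) + e * (T + T))         ≡⟨ cong (_+ ((U + V) + e * (T + T))) h₁ ⟩
        (Q + (B + B)) + ((U + V) + e * (T + T))         ≡⟨ r₂ Q T B U V e ⟩
        ((B + e * T) + (B + e * T)) + (Q + (U + V))     ≡⟨ cong (((B + e * T) + (B + e * T)) +_) h₂ ⟨
        ((B + e * T) + (B + e * T)) + (P + e * (T + T)) ∎)
        where
        open ≡-Reasoning
        r₁ : ∀ P T A C U V e → ((A + U) + (C + V)) + (P + e * (T + T)) ≡ (P + (A + C)) + ((U + V) + e * (T + T))
        r₁ = solve-∀
        r₂ : ∀ Q T B U V e → (Q + (B + B)) + ((U + V) + e * (T + T)) ≡ ((B + e * T) + (B + e * T)) + (Q + (U + V))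
        r₂ = solve-∀

    -- The lengths give `i + k ≡ j + j`, which cancels the constant `K` of the probes; dividing by
    -- `D` then leaves the letter counts.
    balanced-totals : ∀ i j k → BalancedFor (total (λ _ → 1)) w 0 i j k →
                      (∀ s → BalancedFor (total (probe s)) w 0 i j k) → Balanced w 0 i j k
    balanced-totals i j k lengths probes = balanced-δ w 0 λ s →
      *-cancelˡ-≡ _ _ D (+-cancelʳ-≡ ((i + k) * K) _ _ (begin
        D * (mass (δ s) w i + mass (δ s) w k) + (i + k) * K       ≡⟨ expand (mass (δ s) w i) (mass (δ s) w k) i k ⟩
        (D * mass (δ s) w i + i * K) + (D * mass (δ s) w k + k * K) ≡⟨ cong₂ _+_ (mass-total s i) (mass-total s k) ⟨
        mass (total (probe s)) w i + mass (total (probe s)) w k   ≡⟨ probes s ⟩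
        mass (total (probe s)) w j + mass (total (probe s)) w j   ≡⟨ cong₂ _+_ (mass-total s j) (mass-total s j) ⟩
        (D * mass (δ s) w j + j * K) + (D * mass (δ s) w j + j * K) ≡⟨ expand (mass (δ s) w j) (mass (δ s) w j) j j ⟨
        D * (mass (δ s) w j + mass (δ s) w j) + (j + j) * K       ≡⟨ cong (λ n → D * (mass (δ s) w j + mass (δ s) w j) + n * K) i+k≡j+j ⟨
        D * (mass (δ s) w j + mass (δ s) w j) + (i + k) * K       ∎))
      where
      open ≡-Reasoning
      mass-total : ∀ s N → mass (total (probe s)) w N ≡ D * mass (δ s) w N + N * K
      mass-total s N = trans (mass-cong-weight w N (probesSeparate s)) (mass-affine (δ s) D K w N)
      expand : ∀ u v i k → D * (u + v) + (i + k) * K ≡ (D * u + i * K) + (D * v + k * K)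
      expand u v i k = expand′ D K u v i k
        where
        expand′ : ∀ D K u v i k → D * (u + v) + (i + k) * K ≡ (D * u + i * K) + (D * v + k * K)
        expand′ = solve-∀
      mass-lengths : ∀ N → mass (total (λ _ → 1)) w N ≡ N * q
      mass-lengths N = trans (mass-cong-weight w N λ a → mass-1 (block a) q) (mass-const q w N)
      i+k≡j+j : i + k ≡ j + j
      i+k≡j+j = *-cancelʳ-≡ (i + k) (j + j) q (begin
        (i + k) * q       ≡⟨ *-distribʳ-+ q i k ⟩
        i * q + k * q     ≡⟨ cong₂ _+_ (mass-lengths i) (mass-lengths k) ⟨
        _                 ≡⟨ lengths ⟩
        _                 ≡⟨ cong₂ _+_ (mass-lengths j) (mass-lengths j) ⟩
        j * q + j * q     ≡⟨ *-distribʳ-+ q j j ⟨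
        (j + j) * q       ∎)

    balanced-offsets : ∀ {i j k} → Balanced x ι i j k →
                       (i % q + k % q) % q ≡ (j % q + (ι + j % q)) % q
    balanced-offsets {i} {j} {k} bal =
      trans (sym (cong (_% q) (cong₂ _+_ (mass-1 (block (letter i)) (i % q)) (mass-1 (block (letter k)) (k % q)))))
        (trans (balanced-% (λ _ → 1) q q∣total i j k (balances bal (λ _ → 1)))
          (cong (_% q) (cong₂ _+_ (mass-1 (block (letter j)) (j % q)) (mass-1 (block (letter j)) (ι + j % q)))))
      where
      q∣total : ∀ a → q ∣ total (λ _ → 1) a
      q∣total a = subst (q ∣_) (sym (mass-1 (block a) q)) ∣-refl

    desubstitute : ∀ {i j k} → Balanced x ι i j k →
      Σ[ ε₁ ∈ Fin 2 ] Σ[ ε₂ ∈ Fin 2 ] Σ[ ε₃ ∈ Fin 2 ]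
        Balanced w 0 (toℕ ε₁ + i / q) (toℕ ε₂ + j / q) (toℕ ε₃ + k / q)
    desubstitute {i} {j} {k} bal
      with ε₁ , ε₂ , ε₃ , lengths , probes ←
        allAlignable (m%n<n i q) (m%n<n j q) (m%n<n k q) (balanced-offsets bal) (letter i) (letter j) (letter k)
          (balanced-% key d (λ a → m%n≡0⇒n∣m _ d (keyDivides a)) i j k (balances bal key))
      = ε₁ , ε₂ , ε₃ ,
        balanced-totals _ _ _
          (align (λ _ → 1) i j k ε₁ ε₂ ε₃ (balances bal (λ _ → 1)) lengths)
          (λ s → align (probe s) i j k ε₁ ε₂ ε₃ (balances bal (probe s)) (probes s))

    x-twoBlocks : ∀ N {t} → t < q + q → x (N * q + t) ≡ twoBlocks (w N) (w (suc N)) t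
    x-twoBlocks N {t} t<2q with t <ᵇ q | <ᵇ-reflects-< t q
    ... | true  | ofʸ t<q = x-blocks N t<q
    ... | false | ofⁿ t≮q = begin
      x (N * q + t)               ≡⟨ cong (λ s → x (N * q + s)) (m+[n∸m]≡n q≤t) ⟨
      x (N * q + (q + (t ∸ q)))   ≡⟨ cong x (regroup (N * q) q (t ∸ q)) ⟩
      x (q + N * q + (t ∸ q))     ≡⟨ x-blocks (suc N) (+-cancelˡ-< q _ _ (subst (_< q + q) (sym (m+[n∸m]≡n q≤t)) t<2q)) ⟩
      block (w (suc N)) (t ∸ q)   ∎
      where
      open ≡-Reasoning
      q≤t = ≮⇒≥ t≮q
      regroup : ∀ a b c → a + (b + c) ≡ b + a + c
      regroup = solve-∀

    mass-twoBlocks : ∀ f N {t} → t ≤ q + q →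
      mass f x (N * q + t) ≡ mass f x (N * q) + mass f (twoBlocks (w N) (w (suc N))) t
    mass-twoBlocks f N {t} t≤2q =
      trans (mass-+ f x (N * q) t)
            (cong (mass f x (N * q) +_) (mass-cong f t λ s<t → x-twoBlocks N (<-≤-trans s<t t≤2q)))

    balanced-window : ∀ f N {α β γ} → α < q + q → ι + β < q + q → γ < q + q →
      BalancedFor f x ι (N * q + α) (N * q + β) (N * q + γ) →
      BalancedFor f (twoBlocks (w N) (w (suc N))) ι α β γ
    balanced-window f N {α} {β} {γ} α< β< γ< bal = +-cancelˡ-≡ (M + M) _ _ (begin
      (M + M) + (μ α + μ γ)                            ≡⟨ regroup M (μ α) (μ γ) ⟩
      (M + μ α) + (M + μ γ)                            ≡⟨ cong₂ _+_ (at α<) (at γ<) ⟨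
      mass f x (N * q + α) + mass f x (N * q + γ)      ≡⟨ bal ⟩
      mass f x (N * q + β) + mass f x (ι + (N * q + β)) ≡⟨ cong (λ n → mass f x (N * q + β) + mass f x n) (swap ι (N * q) β) ⟩
      mass f x (N * q + β) + mass f x (N * q + (ι + β)) ≡⟨ cong₂ _+_ (at (≤-<-trans (m≤n+m β ι) β<)) (at β<) ⟩
      (M + μ β) + (M + μ (ι + β))                      ≡⟨ regroup M (μ β) (μ (ι + β)) ⟨
      (M + M) + (μ β + μ (ι + β))                      ∎)
      where
      open ≡-Reasoning
      M = mass f x (N * q)
      μ = mass f (twoBlocks (w N) (w (suc N)))
      at : ∀ {t} → t < q + q → mass f x (N * q + t) ≡ M + μ t
      at t< = mass-twoBlocks f N (<⇒≤ t<)
      regroup : ∀ a b c → (a + a) + (b + c) ≡ (a + b) + (a + c)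
      regroup = solve-∀
      swap : ∀ a b c → a + (b + c) ≡ b + (a + c)
      swap = solve-∀

    -- The square lies in the block of `i` and its successor; removing the prefix before them leaves
    -- a configuration excluded by `noShortSquare`.
    short-contradiction : ∀ {i j k} → suc ι + j ≤ k → SquareFreeBelow w k → Balanced x ι i j k →
                          k / q ≤ suc (i / q) → ⊥
    short-contradiction {i} {j} {k} j<k free bal C≤1+A =
      noShortSquare β<2q γ<2q β<γ (≤-<-trans α≤β β<2q) α+γ (w A) (w (suc A)) distinct
        (balanced-window key A (≤-<-trans α≤β β<2q) (≤-<-trans (<⇒≤ β<γ) γ<2q) γ<2q
          (subst₂ (λ i j → BalancedFor key x ι i j (A * q + γ)) (sym (at Aq≤i)) (sym (at Aq≤j))
            (subst (BalancedFor key x ι i j) (sym (at Aq≤k)) (balances bal key))))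
      where
      A = i / q
      α = i ∸ A * q
      β = j ∸ A * q
      γ = k ∸ A * q
      i≤j : i ≤ j
      i≤j = +-cancelʳ-≤ (suc ι + j) i j (begin
        i + (suc ι + j)   ≤⟨ +-monoʳ-≤ i j<k ⟩
        i + k             ≡⟨ balanced-lengths bal ⟩
        j + (ι + j)       ≤⟨ +-monoʳ-≤ j (n≤1+n (ι + j)) ⟩
        j + (suc ι + j)   ∎)
        where open ≤-Reasoning
      Aq≤i : A * q ≤ i
      Aq≤i = m/n*n≤m i q
      Aq≤j : A * q ≤ j
      Aq≤j = ≤-trans Aq≤i i≤j
      j≤k : j ≤ k
      j≤k = ≤-trans (m≤n+m j (suc ι)) j<k
      Aq≤k : A * q ≤ k
      Aq≤k = ≤-trans Aq≤j j≤k
      at : ∀ {n} → A * q ≤ n → A * q + (n ∸ A * q) ≡ n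
      at = m+[n∸m]≡n
      γ<2q : γ < q + q
      γ<2q = +-cancelˡ-< (A * q) _ _ (begin-strict
        A * q + γ             ≡⟨ at Aq≤k ⟩
        k                     ≡⟨ split k ⟩
        (k / q) * q + k % q   <⟨ +-monoʳ-< ((k / q) * q) (m%n<n k q) ⟩
        (k / q) * q + q       ≤⟨ +-monoˡ-≤ q (*-monoˡ-≤ q C≤1+A) ⟩
        suc A * q + q         ≡⟨ regroup q (A * q) ⟩
        A * q + (q + q)       ∎)
        where
        open ≤-Reasoning
        regroup : ∀ q a → (q + a) + q ≡ a + (q + q)
        regroup = solve-∀
      α≤β : α ≤ β
      α≤β = ∸-monoˡ-≤ (A * q) i≤j
      β<γ : suc ι + β ≤ γ
      β<γ = +-cancelˡ-≤ (A * q) _ _ (begin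
        A * q + (suc ι + β)   ≡⟨ swap (A * q) (suc ι) β ⟩
        suc ι + (A * q + β)   ≡⟨ cong (suc ι +_) (at Aq≤j) ⟩
        suc ι + j             ≤⟨ j<k ⟩
        k                     ≡⟨ at Aq≤k ⟨
        A * q + γ             ∎)
        where
        open ≤-Reasoning
        swap : ∀ a b c → a + (b + c) ≡ b + (a + c)
        swap = solve-∀
      β<2q : β < q + q
      β<2q = ≤-<-trans (≤-trans (m≤n+m β (suc ι)) β<γ) γ<2q
      α+γ : α + γ ≡ β + (ι + β)
      α+γ = +-cancelˡ-≡ (A * q + A * q) _ _ (begin
        (A * q + A * q) + (α + γ)               ≡⟨ regroup (A * q) α γ ⟩
        (A * q + α) + (A * q + γ)               ≡⟨ cong₂ _+_ (at Aq≤i) (at Aq≤k) ⟩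
        i + k                                   ≡⟨ balanced-lengths bal ⟩
        j + (ι + j)                             ≡⟨ cong₂ (λ a b → a + (ι + b)) (at Aq≤j) (at Aq≤j) ⟨
        (A * q + β) + (ι + (A * q + β))         ≡⟨ regroup′ (A * q) ι β ⟩
        (A * q + A * q) + (β + (ι + β))         ∎)
        where
        open ≡-Reasoning
        regroup : ∀ a b c → (a + a) + (b + c) ≡ (a + b) + (a + c)
        regroup = solve-∀
        regroup′ : ∀ a b c → (a + c) + (b + (a + c)) ≡ (a + a) + (c + (b + c))
        regroup′ = solve-∀
      -- Equal neighbours would be an abelian square of `w` ending at `A + 2`, and `k` is larger
      -- because `γ` is at least `q`, hence at least 3.
      distinct : ¬ (w A ≡ w (suc A) × q ≤ γ)
      distinct (same , q≤γ) = free {A} {suc A} {suc (suc A)} ≤-refl 2+A<k (balanced λ f → begin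
        mass f w A + (mass f w A + f (w A) + f (w (suc A)))     ≡⟨ cong (λ a → mass f w A + (mass f w A + f (w A) + f a)) same ⟨
        mass f w A + (mass f w A + f (w A) + f (w A))           ≡⟨ regroup (mass f w A) (f (w A)) ⟩
        (mass f w A + f (w A)) + (mass f w A + f (w A))         ∎)
        where
        open ≡-Reasoning
        regroup : ∀ a b → a + (a + b + b) ≡ (a + b) + (a + b)
        regroup = solve-∀
        2+A<k : 3 + A ≤ k
        2+A<k = ≤-trans (+-mono-≤ (≤-trans 3≤q q≤γ) (m≤m*n A q))
                        (≤-reflexive (trans (+-comm γ (A * q)) (at Aq≤k)))

    -- The bound on `k` makes the second factor non-empty. Of the boundaries N₁, N₂, N₃ obtained by
    -- desubstitution, either N₁ < N₂, and they form an abelian square of `w` with an earlier end,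
    -- or N₃ ≤ N₁, and `k` is at most one block after `i`.
    squareFree : ∀ {i j k} → suc ι + j ≤ k → SquareFreeBelow w k → ¬ Balanced x ι i j k
    squareFree {i} {j} {k} j<k free bal =
      let ε₁ , ε₂ , ε₃ , balʷ = desubstitute bal in
      byCases ε₁ ε₂ ε₃ (_ <? _) balʷ
      where
      ε≤1 : ∀ (ε : Fin 2) → toℕ ε ≤ 1
      ε≤1 ε = s≤s⁻¹ (toℕ<n ε)
      byCases : ∀ ε₁ ε₂ ε₃ → Dec (toℕ ε₁ + i / q < toℕ ε₂ + j / q) →
                ¬ Balanced w 0 (toℕ ε₁ + i / q) (toℕ ε₂ + j / q) (toℕ ε₃ + k / q)
      byCases ε₁ ε₂ ε₃ (yes N₁<N₂) balʷ = free N₁<N₂ N₃<k balʷ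
        where
        N₂<N₃ : toℕ ε₂ + j / q < toℕ ε₃ + k / q
        N₂<N₃ = midpoint-< (balanced-lengths balʷ) N₁<N₂
        N₃≤1+C : toℕ ε₃ + k / q ≤ suc (k / q)
        N₃≤1+C = +-monoˡ-≤ (k / q) (ε≤1 ε₃)
        1≤C : 1 ≤ k / q
        1≤C = s≤s⁻¹ (≤-trans (s≤s (≤-trans (s≤s z≤n) N₁<N₂)) (≤-trans N₂<N₃ N₃≤1+C))
        -- With C = `k / q`: N₃ ≤ C + 1 < 3C ≤ qC ≤ k, where C ≥ 1 because N₃ is at least 2.
        N₃<k : toℕ ε₃ + k / q < k
        N₃<k = ≤-trans (s≤s N₃≤1+C) (≤-trans (1+n<n*3 1≤C)
                 (≤-trans (*-monoʳ-≤ (k / q) 3≤q) (m/n*n≤m k q)))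
      byCases ε₁ ε₂ ε₃ (no N₁≮N₂) balʷ = short-contradiction j<k free bal
        (≤-trans (m≤n+m (k / q) (toℕ ε₃))
          (≤-trans (midpoint-≤ (balanced-lengths balʷ) (≮⇒≥ N₁≮N₂)) (+-monoˡ-≤ (i / q) (ε≤1 ε₁))))

-- The morphisms h and g with their keys and probes.

nth : {A : Set} → A → List A → ℕ → A
nth d []       t       = d
nth d (x ∷ xs) zero    = x
nth d (x ∷ xs) (suc t) = nth d xs t

innerBlock : Fin 5 → ℕ → Fin 5
innerBlock a t = (toℕ a + nth 0 (0 ∷ 1 ∷ 2 ∷ 1 ∷ 4 ∷ 0 ∷ 4 ∷ 1 ∷ 4 ∷ 3 ∷ 1 ∷ 0 ∷ []) t) mod 5

-- The first row of 732 M⁻¹, where M is the incidence matrix of h and 732 its determinant, shifted by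
-- 122 so that the entries are natural numbers and 61 divides all block totals; the other rows are
-- its rotations.
innerKey : Fin 5 → ℕ
innerKey a = nth 0 (79 ∷ 307 ∷ 7 ∷ 55 ∷ 223 ∷ []) (toℕ a)

-- As h commutes with the translations of ℤ/5, its incidence matrix and the inverse are circulant;
-- `5 ∸ toℕ s` stands for minus `s` modulo 5.
innerProbe : Fin 5 → Fin 5 → ℕ
innerProbe s a = innerKey ((toℕ a + (5 ∸ toℕ s)) mod 5)

outerWord : Fin 5 → List (Fin 3)
outerWord 0F = 0F ∷ 0F ∷ 1F ∷ 1F ∷ 2F ∷ []
outerWord 1F = 0F ∷ 0F ∷ 2F ∷ 1F ∷ 2F ∷ []
outerWord 2F = 0F ∷ 2F ∷ 2F ∷ 0F ∷ 1F ∷ []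
outerWord 3F = 0F ∷ 2F ∷ 2F ∷ 1F ∷ 1F ∷ []
outerWord 4F = 0F ∷ 2F ∷ 2F ∷ 2F ∷ 0F ∷ []

outerLetter : Fin 5 → ℕ → Fin 3
outerLetter a = nth 0F (outerWord a)

-- All five words begin with 0F, so the default value of nth past the end of a word is also the first
-- letter of the next block.
outerBlock : Fin 5 → ℕ → Fin 9
outerBlock a t = combine (outerLetter a t) (outerLetter a (suc t))

-- Found by random search among the weights that vanish modulo 32 on every block.
outerKey : Fin 9 → ℕ
outerKey p = nth 0 (24 ∷ 3 ∷ 19 ∷ 16 ∷ 9 ∷ 29 ∷ 31 ∷ 57 ∷ 27 ∷ []) (toℕ p)

-- Each probe marks two letter pairs, which together occur twice in the block of `s` and once in
-- every other block.
outerProbe : Fin 5 → Fin 9 → ℕ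
outerProbe s p = nth 0 (table s) (toℕ p)
  where
  table : Fin 5 → List ℕ
  table 0F = 0 ∷ 0 ∷ 0 ∷ 0 ∷ 1 ∷ 0 ∷ 1 ∷ 0 ∷ 0 ∷ []
  table 1F = 0 ∷ 0 ∷ 0 ∷ 0 ∷ 0 ∷ 0 ∷ 1 ∷ 1 ∷ 0 ∷ []
  table 2F = 0 ∷ 0 ∷ 0 ∷ 1 ∷ 0 ∷ 0 ∷ 1 ∷ 0 ∷ 0 ∷ []
  table 3F = 0 ∷ 0 ∷ 1 ∷ 0 ∷ 1 ∷ 0 ∷ 0 ∷ 0 ∷ 0 ∷ []
  table 4F = 0 ∷ 0 ∷ 0 ∷ 0 ∷ 0 ∷ 1 ∷ 0 ∷ 0 ∷ 1 ∷ []

-- For h, `D` is the determinant 732 and `K` = 1464 = 12 * 122 comes from the shift by 122. For g, a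
-- probe totals 2 on its own block and 1 on the others, so `D` and `K` are both 1.
module Inner = Desubstitution 0 12 61 732 1464 innerBlock innerProbe innerKey
module Outer = Desubstitution 1 5 32 1 1 outerBlock outerProbe outerKey

-- Finite checks, decided by evaluation.

innerAlignable : Inner.AllAlignable
innerAlignable {α} = from-yes Inner.allAlignable? {α}

innerNoShortSquare : Inner.NoShortSquare
innerNoShortSquare {β} = from-yes Inner.noShortSquare? {β}

outerAlignable : Outer.AllAlignable
outerAlignable {α} = from-yes Outer.allAlignable? {α}

outerNoShortSquare : Outer.NoShortSquare
outerNoShortSquare {β} = from-yes Outer.noShortSquare? {β}

-- The fixed point w of h has no abelian squares.

-- The first argument is fuel; the index divides down to 0 well before n steps are used up.
innerUpTo : ℕ → ℕ → Fin 5
innerUpTo zero       n = 0F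
innerUpTo (suc fuel) n = innerBlock (innerUpTo fuel (n / 12)) (n % 12)

inner : InfiniteWord 5
inner n = innerUpTo n n

quotient-≤ : ∀ {n k} → n ≤ suc k → n / 12 ≤ k
quotient-≤ {zero}  _     = z≤n
quotient-≤ {suc n} n≤1+k = s≤s⁻¹ (≤-trans (m/n<m (suc n) 12 (s≤s (s≤s z≤n))) n≤1+k)

innerUpTo-fuel : ∀ k l {n} → n ≤ k → n ≤ l → innerUpTo k n ≡ innerUpTo l n
innerUpTo-fuel zero    zero    n≤k n≤l = refl
-- Running out of fuel at index 0 is harmless: h(0) begins with 0, so `innerBlock 0F 0` is `0F`.
innerUpTo-fuel zero    (suc l) z≤n n≤l = cong (λ a → innerBlock a 0) (innerUpTo-fuel zero l z≤n z≤n)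
innerUpTo-fuel (suc k) zero    n≤k z≤n = cong (λ a → innerBlock a 0) (innerUpTo-fuel k zero z≤n z≤n)
innerUpTo-fuel (suc k) (suc l) {n} n≤k n≤l =
  cong (λ a → innerBlock a (n % 12)) (innerUpTo-fuel k l (quotient-≤ n≤k) (quotient-≤ n≤l))

inner-fixed : ∀ n → inner n ≡ innerBlock (inner (n / 12)) (n % 12)
inner-fixed n = trans (innerUpTo-fuel n (suc n) ≤-refl (n≤1+n n))
  (cong (λ a → innerBlock a (n % 12)) (innerUpTo-fuel n (n / 12) (m/n≤m n 12) ≤-refl))

[N*q+t]/q≡N : ∀ N q {t} .{{_ : NonZero q}} → t < q → (N * q + t) / q ≡ N
[N*q+t]/q≡N N q {t} t<q = begin
  (N * q + t) / q       ≡⟨ +-distrib-/-∣ˡ t (n∣m*n N) ⟩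
  N * q / q + t / q     ≡⟨ cong₂ _+_ (m*n/n≡m N q) (m<n⇒m/n≡0 t<q) ⟩
  N + 0                 ≡⟨ +-identityʳ N ⟩
  N                     ∎
  where open ≡-Reasoning

[N*q+t]%q≡t : ∀ N q {t} .{{_ : NonZero q}} → t < q → (N * q + t) % q ≡ t
[N*q+t]%q≡t N q {t} t<q = trans (%-remove-+ˡ t (n∣m*n N)) (m<n⇒m%n≡m t<q)

inner-blocks : ∀ N {t} → t < 12 → inner (N * 12 + t) ≡ innerBlock (inner N) t
inner-blocks N {t} t<12 = trans (inner-fixed (N * 12 + t))
  (cong₂ (λ n s → innerBlock (inner n) s) ([N*q+t]/q≡N N 12 t<12) ([N*q+t]%q≡t N 12 t<12))

module InnerImage = Inner.Image (m≤m+n 3 9) z≤n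
  (from-yes Inner.keyDivides?) (from-yes Inner.probesSeparate?) innerAlignable innerNoShortSquare
  inner inner inner-blocks

-- `inner` is its own image, so what the descent assumes about `w` is the induction hypothesis.
inner-squareFree : ∀ n → SquareFreeBelow inner n
inner-squareFree (suc n) i<j k<1+n bal =
  InnerImage.squareFree (midpoint-< (balanced-lengths bal) i<j)
    (λ i<j k′<k → inner-squareFree n i<j (<-≤-trans k′<k (s≤s⁻¹ k<1+n))) bal

-- The ternary word g(w) and its word of letter pairs.

pairs : ∀ {q} → InfiniteWord q → InfiniteWord (q * q)
pairs x n = combine (x n) (x (suc n))

outer : InfiniteWord 3
outer n = outerLetter (inner (n / 5)) (n % 5)

outer-inside : ∀ N {t} → t < 5 → outer (N * 5 + t) ≡ outerLetter (inner N) t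
outer-inside N t<5 =
  cong₂ (λ n s → outerLetter (inner n) s) ([N*q+t]/q≡N N 5 t<5) ([N*q+t]%q≡t N 5 t<5)

outerLetter-0 : ∀ a → outerLetter a 0 ≡ 0F
outerLetter-0 = from-yes (all? λ a → outerLetter a 0 ≟ 0F)

outerLetter-5 : ∀ a → outerLetter a 5 ≡ 0F
outerLetter-5 = from-yes (all? λ a → outerLetter a 5 ≟ 0F)

outer-end : ∀ N → outer (N * 5 + 5) ≡ outerLetter (inner N) 5
outer-end N = begin
  outer (N * 5 + 5)              ≡⟨ cong outer (trans (+-comm (N * 5) 5) (sym (+-identityʳ (suc N * 5)))) ⟩
  outer (suc N * 5 + 0)          ≡⟨ outer-inside (suc N) (s≤s z≤n) ⟩
  outerLetter (inner (suc N)) 0  ≡⟨ outerLetter-0 (inner (suc N)) ⟩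
  0F                             ≡⟨ outerLetter-5 (inner N) ⟨
  outerLetter (inner N) 5        ∎
  where open ≡-Reasoning

outer-at : ∀ N {t} → t ≤ 5 → outer (N * 5 + t) ≡ outerLetter (inner N) t
outer-at N t≤5 with m≤n⇒m<n∨m≡n t≤5
... | inj₁ t<5  = outer-inside N t<5
... | inj₂ refl = outer-end N

-- The last pair of a block uses the first letter of the next block, which is always 0. Hence the
-- word of pairs is again a 5-uniform image of w.
outer-blocks : ∀ N {t} → t < 5 → pairs outer (N * 5 + t) ≡ outerBlock (inner N) t
outer-blocks N {t} t<5 = cong₂ combine (outer-at N (<⇒≤ t<5))
  (trans (cong outer (sym (+-suc (N * 5) t))) (outer-at N t<5))

module OuterImage = Outer.Image (m≤m+n 3 2) ≤-refl
  (from-yes Outer.keyDivides?) (from-yes Outer.probesSeparate?) outerAlignable outerNoShortSquare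
  inner (pairs outer) outer-blocks

pairs-squareFree : ∀ {i j k} → 2 + j ≤ k → ¬ Balanced (pairs outer) 1 i j k
pairs-squareFree {k = k} 2+j≤k = OuterImage.squareFree 2+j≤k (inner-squareFree k)

-- Occurrences of words of length one and two

mass-suc : {A : Set} (f : A → ℕ) (x : ℕ → A) (n : ℕ) →
           mass f x (suc n) ≡ f (x 0) + mass f (λ t → x (suc t)) n
mass-suc f x n = mass-+ f x 1 n

occurrences-letter : ∀ {q} (x : InfiniteWord q) a n → ∣ applyUpTo x n ∣[ a ∷ [] ] ≡ mass (δ a) x n
occurrences-letter x a zero    = refl
occurrences-letter x a (suc n) = trans head (sym (mass-suc (δ a) x n))
  where
  head : ∣ applyUpTo x (suc n) ∣[ a ∷ [] ] ≡ δ a (x 0) + mass (δ a) (λ t → x (suc t)) n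
  head with IH ← occurrences-letter (λ t → x (suc t)) a n | does (a ≟ x 0)
  ... | true  = cong suc IH
  ... | false = IH

-- The right-hand side has the Boolean that `prefix?` computes for `a ∷ b ∷ []`; its final `true`
-- comes from the empty rest of the prefix.
δ-combine : ∀ {m n} (a c : Fin m) (b d : Fin n) →
            δ (combine a b) (combine c d) ≡ (if does (a ≟ c) ∧ (does (b ≟ d) ∧ true) then 1 else 0)
δ-combine a c b d = cong (if_then 1 else 0) (trans
  (does-⇔ (mk⇔ (combine-injective a b c d) (λ (p , r) → cong₂ combine p r)) (combine a b ≟ combine c d) ((a ≟ c) ×-dec (b ≟ d)))
  (cong (does (a ≟ c) ∧_) (sym (∧-identityʳ _))))

occurrences-pair : ∀ {q} (x : InfiniteWord q) a b n →
                   ∣ applyUpTo x (suc n) ∣[ a ∷ b ∷ [] ] ≡ mass (δ (combine a b)) (pairs x) n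
occurrences-pair x a b zero with does (a ≟ x 0)
... | true  = refl
... | false = refl
occurrences-pair x a b (suc n) = trans head (sym (mass-suc (δ (combine a b)) (pairs x) n))
  where
  head : ∣ applyUpTo x (2 + n) ∣[ a ∷ b ∷ [] ] ≡
         δ (combine a b) (pairs x 0) + mass (δ (combine a b)) (λ t → pairs x (suc t)) n
  head rewrite δ-combine a (x 0) b (x 1)
    with IH ← occurrences-pair (λ t → x (suc t)) a b n | does (a ≟ x 0) ∧ (does (b ≟ x 1) ∧ true)
  ... | true  = cong suc IH
  ... | false = IH

-- From 2-abelian squares to balanced triples.

++-applyUpTo : {A : Set} (f : ℕ → A) (u v : List A) → u ++ v ≡ applyUpTo f (length (u ++ v)) →
               u ≡ applyUpTo f (length u) × v ≡ applyUpTo (λ t → f (length u + t)) (length v)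
++-applyUpTo f []      v eq = refl , eq
++-applyUpTo f (a ∷ u) v eq
  with a≡ , eq′ ← ∷-injective eq
  with u≡ , v≡ ← ++-applyUpTo (λ t → f (suc t)) u v eq′
  = cong₂ _∷_ a≡ u≡ , v≡

-- Equivalence speaks of counts only; the length is recovered as the sum of the letter counts.
equivalent-lengths : ∀ {q} (x y : InfiniteWord q) {m n} →
                     KAbelianEquivalent 2 (applyUpTo x m) (applyUpTo y n) → m ≡ n
equivalent-lengths x y {m} {n} equivalent = begin
  m                                          ≡⟨ mass-1 x m ⟨
  mass (λ _ → 1) x m                         ≡⟨ mass-∑ _ x m ⟩
  sum (λ a → 1 * mass (δ a) x m)             ≡⟨ sum-cong-≗ (λ a → cong (1 *_) (letters a)) ⟩
  sum (λ a → 1 * mass (δ a) y n)             ≡⟨ mass-∑ _ y n ⟨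
  mass (λ _ → 1) y n                         ≡⟨ mass-1 y n ⟩
  n                                          ∎
  where
  open ≡-Reasoning
  letters : ∀ a → mass (δ a) x m ≡ mass (δ a) y n
  letters a = trans (sym (occurrences-letter x a m))
    (trans (equivalent (a ∷ []) (λ ()) (s≤s z≤n)) (occurrences-letter y a n))

equivalent-pairs : ∀ {q} (x y : InfiniteWord q) n →
                   KAbelianEquivalent 2 (applyUpTo x (suc n)) (applyUpTo y (suc n)) →
                   ∀ p → mass (δ p) (pairs x) n ≡ mass (δ p) (pairs y) n
equivalent-pairs {q} x y n equivalent p
  with a , b , refl ← combine-surjective {q} {q} p
  = trans (sym (occurrences-pair x a b n))
      (trans (equivalent (a ∷ b ∷ []) (λ ()) ≤-refl) (occurrences-pair y a b n))

-- Each half has `n + 1` letters and thus `n` pairs. The pair at position `i + n` straddles the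
-- middle and belongs to neither half, which is the gap `ι` = 1.
square⇒balanced : ∀ {q} (x : InfiniteWord q) i n →
  KAbelianEquivalent 2 (applyUpTo (λ t → x (i + t)) (suc n)) (applyUpTo (λ t → x (i + (suc n + t))) (suc n)) →
  Balanced (pairs x) 1 i (i + n) (suc (i + n) + n)
square⇒balanced x i n equivalent = balanced-δ (pairs x) 1 λ p → begin
  M p i + M p (suc (i + n) + n)                        ≡⟨ cong (M p i +_) (mass-+ (δ p) (pairs x) (suc (i + n)) n) ⟩
  M p i + (M p (suc (i + n)) + window p (suc (i + n)))  ≡⟨ regroup (M p i) (M p (suc (i + n))) _ ⟩
  (M p i + window p (suc (i + n))) + M p (suc (i + n))  ≡⟨ cong (λ k → (M p i + k) + M p (suc (i + n))) (windows p) ⟨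
  (M p i + window p i) + M p (suc (i + n))              ≡⟨ cong (_+ M p (suc (i + n))) (mass-+ (δ p) (pairs x) i n) ⟨
  M p (i + n) + M p (suc (i + n))                      ∎
  where
  open ≡-Reasoning
  M = λ p → mass (δ p) (pairs x)
  window = λ p k → mass (δ p) (λ t → pairs x (k + t)) n
  regroup : ∀ a b c → a + (b + c) ≡ (a + c) + b
  regroup = solve-∀
  shift : ∀ t → i + (suc n + t) ≡ suc (i + n) + t
  shift t = trans (sym (+-assoc i (suc n) t)) (cong (_+ t) (+-suc i n))
  windows : ∀ p → window p i ≡ window p (suc (i + n))
  windows p = begin
    window p i                                               ≡⟨ mass-cong (δ p) n (λ {t} _ → cong (λ k → combine (x (i + t)) (x k)) (+-suc i t)) ⟨
    mass (δ p) (pairs (λ t → x (i + t))) n                   ≡⟨ equivalent-pairs (λ t → x (i + t)) (λ t → x (i + (suc n + t))) n equivalent p ⟩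
    mass (δ p) (pairs (λ t → x (i + (suc n + t)))) n         ≡⟨ mass-cong (δ p) n (λ {t} _ → cong₂ (λ k l → combine (x k) (x l)) (shift t) (trans (shift (suc t)) (+-suc (suc (i + n)) t))) ⟩
    window p (suc (i + n))                                   ∎

mainTheorem5 : Σ[ x ∈ InfiniteWord 3 ]
    (∀ (v : Word 3) → v IsFactorOf x →
    ¬ (Σ[ s ∈ KAbelianSquare 2 v ] 2 ≤ KAbelianSquare.period s))
mainTheorem5 = outer , λ { _ (i , factor) (record { u₁ = u₁ ; u₂ = u₂ ; split = refl ; equivalent = equivalent } , 2≤period) →
  noSquare i u₁ u₂ (++-applyUpTo (λ t → outer (i + t)) u₁ u₂ factor) equivalent 2≤period }
  where
  noSquareAt : ∀ i m n → KAbelianEquivalent 2 (applyUpTo (λ t → outer (i + t)) m) (applyUpTo (λ t → outer (i + (m + t))) n) →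
               ¬ 2 ≤ m
  noSquareAt i (suc m) n equivalent 2≤1+m
    with refl ← equivalent-lengths (λ t → outer (i + t)) (λ t → outer (i + (suc m + t))) equivalent
    -- Period at least 2 gives `m` ≥ 1, so each half contains at least one pair.
    = pairs-squareFree (s≤s (≤-trans (≤-reflexive (+-comm 1 (i + m))) (+-monoʳ-≤ (i + m) (s≤s⁻¹ 2≤1+m))))
        (square⇒balanced outer i m equivalent)
  noSquare : ∀ i (u₁ u₂ : Word 3) →
    u₁ ≡ applyUpTo (λ t → outer (i + t)) (length u₁) ×
    u₂ ≡ applyUpTo (λ t → outer (i + (length u₁ + t))) (length u₂) →
    KAbelianEquivalent 2 u₁ u₂ → ¬ 2 ≤ length u₁
  noSquare i u₁ u₂ (u₁≡ , u₂≡) equivalent =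
    noSquareAt i (length u₁) (length u₂) (subst₂ (KAbelianEquivalent 2) u₁≡ u₂≡ equivalent)
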